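{- Let $\alpha_1,\alpha_2\ge0$. Let $\mathbf{x}=(x_s)\in(\mathbb{R}_{>0})^{\mathbb{Z}^2}$ satisfy, for all $v\in\mathbb{Z}^2$ (with $z_{ij}=x_{v+(i,j)}$), $$0=z_{00}^2z_{12}^2+z_{10}^2z_{02}^2+\tfrac{\alpha_2^2-\alpha_1^2}{4}z_{01}^2z_{11}^2-\alpha_1(z_{00}z_{02}z_{11}^2+z_{10}z_{12}z_{01}^2)-2z_{00}z_{10}z_{02}z_{12}-\alpha_2(z_{00}z_{12}z_{01}z_{11}+z_{10}z_{02}z_{01}z_{11}),$$ and assume $z_{12}$ is the larger real root: $z_{12}=\dfrac{\alpha_1z_{10}z_{01}^2+2z_{00}z_{10}z_{02}+\alpha_2z_{00}z_{01}z_{11}+\sqrt D}{2z_{00}^2}$, where $D=(\alpha_1z_{01}^2+4z_{00}z_{02})(\alpha_1(z_{00}^2z_{11}^2+z_{01}^2z_{10}^2)+2\alpha_2z_{00}z_{01}z_{10}z_{11})$. Then for all $v\in\mathbb{Z}^2$, $$\prod_{i=1}^4R^{B_i,0}_{w_i}(\mathbf{x})=R^{S_1,1}(\mathbf{x})R^{S_2,1}(\mathbf{x})R^{C_1,2}(\mathbf{x})R^{C_2,2}(\mathbf{x})\quad\text{and}\quad R^{B_1,0}_{w_1}(\mathbf{x})R^{B_3,0}_{w_3}(\mathbf{x})=R^{B_2,0}_{w_2}(\mathbf{x})R^{B_4,0}_{w_4}(\mathbf{x}),$$ where $B_1=v+[0,1]\times[0,2]$, $w_1=v+(1,2)$; $B_2=v+[-1,0]\times[0,2]$,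 $w_2=v+(-1,2)$; $B_3=v+[-1,0]\times[-1,1]$, $w_3=v+(-1,-1)$; $B_4=v+[0,1]\times[-1,1]$, $w_4=v+(1,-1)$; $S_1=v+\{0\}\times[0,2]$, $S_2=v+\{0\}\times[-1,1]$; $C_1=v+[0,1]^2$, $C_2=v+[-1,0]\times[0,1]$.
   Context: For a rectangle $B=u+\{0,\varepsilon_1\}\times\{0,\varepsilon_2,2\varepsilon_2\}$-spanned box (width $1$ horizontally, height $2$ vertically) with distinguished corner $w=u+(\varepsilon_1,2\varepsilon_2)$, $\varepsilon_1,\varepsilon_2\in\{\pm1\}$, put $z_{ij}=x_{u+(\varepsilon_1i,\varepsilon_2j)}$ for $i\in\{0,1\}$, $j\in\{0,1,2\}$ and $R^{B,0}_w(\mathbf{x})=z_{00}^2z_{12}-\alpha_1z_{10}z_{01}^2-2z_{00}z_{10}z_{02}-\alpha_2z_{00}z_{01}z_{11}$. For a vertical segment $S$ with lattice points $z_{00},z_{01},z_{02}$ in order, $R^{S,1}(\mathbf{x})=\alpha_1z_{01}^2+4z_{00}z_{02}$. For a unit square $C$ with vertex values $z_{00},z_{01},z_{10},z_{11}$ (via $C\cong\{0,1\}^2$), $R^{C,2}(\mathbf{x})=\alpha_1(z_{00}^2z_{11}^2+z_{01}^2z_{10}^2)+2\alpha_2z_{00}z_{01}z_{10}z_{11}$.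
   Formalization: In R^{B,0}_w the leading term z_{00}^2 z_{12} is corrected to 2 z_{00}^2 z_{12}; with the printed coefficient the first identity fails, e.g. for α_1=α_2=0 and x≡1 (left side 1, right side 0). -}

module Defs where

open import Algebra.Apartness.Bundles using (HeytingField)
open import Algebra.Bundles using (CommutativeRing)
import Algebra.Apartness.Properties.HeytingCommutativeRing as HCRProperties
import Algebra.Properties.Ring as RingProperties
open import Data.Integer.Base as ℤ using (ℤ; +_; -[1+_]; _◃_)
import Data.Integer.Properties as ℤₚ
open import Data.Nat.Base as ℕ using (ℕ)
open import Data.Nat.GeneralisedArithmetic using (fold)
open import Data.Product.Base using (_×_; _,_; ∃-syntax; proj₁)
open import Data.Sign.Base as Sign using (Sign)
open import Data.Sum.Base using (_⊎_; inj₁; inj₂)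
open import Level using (_⊔_) renaming (suc to lsuc)
open import Relation.Binary.Core using (Rel)
open import Relation.Binary.Definitions using (Cotransitive)
open import Relation.Binary.PropositionalEquality using (_≡_; cong₂)
open import Relation.Binary.Structures using (IsStrictPartialOrder)
open import Relation.Nullary.Negation using (¬_; contradiction)

-- The real numbers, given by their axioms: an Archimedean, Cauchy-complete
-- ordered field.  Classically ℝ is the only model up to isomorphism.  The order
-- axioms are the constructive ones (cotransitivity in place of trichotomy), so
-- that the Cauchy reals are a model without excluded middle.

record Reals c ℓ₁ ℓ₂ ℓ₃ : Set (lsuc (c ⊔ ℓ₁ ⊔ ℓ₂ ⊔ ℓ₃)) where
  infix 4 _<_ _≤_
  field
    heytingField : HeytingField c ℓ₁ ℓ₂

  open HeytingField heytingField public

  field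
    _<_                    : Rel Carrier ℓ₃
    <-isStrictPartialOrder : IsStrictPartialOrder _≈_ _<_
    <-cotrans              : Cotransitive _<_
    <⇒#                    : ∀ {x y} → x < y → x # y
    #⇒<⊎>                  : ∀ {x y} → x # y → x < y ⊎ y < x
    +-monoˡ-<              : ∀ {x y} z → x < y → x + z < y + z
    0<x∧0<y⇒0<x*y          : ∀ {x y} → 0# < x → 0# < y → 0# < x * y

  _≤_ : Rel Carrier ℓ₃
  x ≤ y = ¬ (y < x)

  fromℕ : ℕ → Carrier
  fromℕ n = fold 0# (λ y → 1# + y) n

  ∣_-_∣<_ : Carrier → Carrier → Carrier → Set ℓ₃
  ∣ x - y ∣< ε = x < y + ε × y < x + ε

  IsCauchy : (ℕ → Carrier) → Set (c ⊔ ℓ₃)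
  IsCauchy s = ∀ ε → 0# < ε →
    ∃[ N ] (∀ m n → N ℕ.≤ m → N ℕ.≤ n → ∣ s m - s n ∣< ε)

  _ConvergesTo_ : (ℕ → Carrier) → Carrier → Set (c ⊔ ℓ₃)
  s ConvergesTo l = ∀ ε → 0# < ε → ∃[ N ] (∀ n → N ℕ.≤ n → ∣ s n - l ∣< ε)

  field
    archimedean : ∀ x → ∃[ n ] x < fromℕ n
    complete    : ∀ s → IsCauchy s → ∃[ l ] s ConvergesTo l

  open IsStrictPartialOrder <-isStrictPartialOrder public
    using (<-respʳ-≈; <-respˡ-≈)
    renaming (irrefl to <-irrefl; trans to <-trans; asym to <-asym)

  infix 9 _²
  _² : Carrier → Carrier
  x ² = x * x

  2# 4# : Carrier
  2# = 1# + 1#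
  4# = 2# + 2#

  -- Division takes a proof that the denominator is positive; its value does
  -- not depend on that proof up to _≈_.
  infixl 7 _/_∵_
  _/_∵_ : (x y : Carrier) → 0# < y → Carrier
  x / y ∵ 0<y = x * proj₁ (#⇒invertible (#-sym (<⇒# 0<y)))

  -- s = √ d
  _IsSqrtOf_ : Carrier → Carrier → Set (ℓ₁ ⊔ ℓ₃)
  s IsSqrtOf d = 0# ≤ s × s ² ≈ d

  private
    open HCRProperties heytingCommutativeRing using (1#0)

    cring : CommutativeRing c ℓ₁
    cring = record { isCommutativeRing = isCommutativeRing }

    open RingProperties (CommutativeRing.ring cring)
      using (-‿distribˡ-*; -‿involutive)

  0<1 : 0# < 1#
  0<1 with #⇒<⊎> 1#0
  ... | inj₂ p = p
  ... | inj₁ 1<0 = contradiction (<-respʳ-≈ -1*-1≈1 (0<x∧0<y⇒0<x*y 0<-1 0<-1)) (<-asym 1<0)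
    where
    0<-1 : 0# < - 1#
    0<-1 = <-respˡ-≈ (-‿inverseʳ 1#) (<-respʳ-≈ (+-identityˡ (- 1#)) (+-monoˡ-< (- 1#) 1<0))

    -1*-1≈1 : - 1# * - 1# ≈ 1#
    -1*-1≈1 = trans (sym (-‿distribˡ-* 1# (- 1#)))
                    (trans (-‿cong (*-identityˡ (- 1#))) (-‿involutive 1#))

  0<x⇒0<x+x : ∀ {x} → 0# < x → 0# < x + x
  0<x⇒0<x+x {x} p = <-trans p (<-respˡ-≈ (+-identityˡ x) (+-monoˡ-< x p))

  0<2 : 0# < 2#
  0<2 = 0<x⇒0<x+x 0<1

  0<4 : 0# < 4#
  0<4 = 0<x⇒0<x+x 0<2

  0<2x² : ∀ {x} → 0# < x → 0# < 2# * x ²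
  0<2x² p = 0<x∧0<y⇒0<x*y 0<2 (0<x∧0<y⇒0<x*y p p)


Point : Set
Point = ℤ × ℤ

infixl 6 _⊕_
_⊕_ : Point → Point → Point
(a , b) ⊕ (a′ , b′) = (a ℤ.+ a′ , b ℤ.+ b′)

-- The 1 × 2 box spanned by u + {0, ε₁} × {0, ε₂, 2ε₂}, together with its
-- distinguished corner w = u + (ε₁, 2ε₂); u is the corner opposite to w.
record MarkedBox : Set where
  constructor box
  field
    u     : Point
    ε₁ ε₂ : Sign

  point : ℕ → ℕ → Point
  point i j = u ⊕ (ε₁ ◃ i , ε₂ ◃ j)

  w : Point
  w = point 1 2

module _ (v : Point) where

  -- v + [0,1] × [0,2], w = v + (1,2)
  B₁ : MarkedBox
  B₁ = box v Sign.+ Sign.+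

  -- v + [-1,0] × [0,2], w = v + (-1,2)
  B₂ : MarkedBox
  B₂ = box v Sign.- Sign.+

  -- v + [-1,0] × [-1,1], w = v + (-1,-1)
  B₃ : MarkedBox
  B₃ = box (v ⊕ (+ 0 , + 1)) Sign.- Sign.-

  -- v + [0,1] × [-1,1], w = v + (1,-1)
  B₄ : MarkedBox
  B₄ = box (v ⊕ (+ 0 , + 1)) Sign.+ Sign.-

  w₁≡ : MarkedBox.w B₁ ≡ v ⊕ (+ 1 , + 2)
  w₁≡ = _≡_.refl

  w₂≡ : MarkedBox.w B₂ ≡ v ⊕ (-[1+ 0 ] , + 2)
  w₂≡ = _≡_.refl

⊕-assoc : ∀ p q r → p ⊕ q ⊕ r ≡ p ⊕ (q ⊕ r)
⊕-assoc (a , b) (a′ , b′) (a″ , b″) = cong₂ _,_ (ℤₚ.+-assoc a a′ a″) (ℤₚ.+-assoc b b′ b″)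

w₃≡ : ∀ v → MarkedBox.w (B₃ v) ≡ v ⊕ (-[1+ 0 ] , -[1+ 0 ])
w₃≡ v = ⊕-assoc v _ _

w₄≡ : ∀ v → MarkedBox.w (B₄ v) ≡ v ⊕ (+ 1 , -[1+ 0 ])
w₄≡ v = ⊕-assoc v _ _


module Recurrence {c ℓ₁ ℓ₂ ℓ₃} (ℝ : Reals c ℓ₁ ℓ₂ ℓ₃)
                  (α₁ α₂ : Reals.Carrier ℝ) (x : Point → Reals.Carrier ℝ) where

  open Reals ℝ

  -- R^{B,0}_w: the partial derivative with respect to z₁₂ = x_w of the
  -- recurrence polynomial below.  Hence the leading coefficient is 2; with
  -- z₀₀² z₁₂ in place of 2 z₀₀² z₁₂ the identities between the R's are false
  -- (α₁ = α₂ = 0, x ≡ 1: the product of four is (-1)⁴ on one side, 0 on the other).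
  R⁰ : MarkedBox → Carrier
  R⁰ B = 2# * z 0 0 ² * z 1 2
       - α₁ * z 1 0 * z 0 1 ²
       - 2# * z 0 0 * z 1 0 * z 0 2
       - α₂ * z 0 0 * z 0 1 * z 1 1
    where
    z : ℕ → ℕ → Carrier
    z i j = x (MarkedBox.point B i j)

  -- R^{S,1} for the vertical segment S = v + {0} × [0,2].
  R¹ : Point → Carrier
  R¹ v = α₁ * z₀ 1 ² + 4# * z₀ 0 * z₀ 2
    where
    z₀ : ℕ → Carrier
    z₀ j = x (v ⊕ (+ 0 , + j))

  -- R^{C,2} for the unit square C = v + [0,1]².
  R² : Point → Carrier
  R² v = α₁ * (z 0 0 ² * z 1 1 ² + z 0 1 ² * z 1 0 ²)
       + 2# * α₂ * z 0 0 * z 0 1 * z 1 0 * z 1 1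
    where
    z : ℕ → ℕ → Carrier
    z i j = x (v ⊕ (+ i , + j))

  SatisfiesRecurrence : Set ℓ₁
  SatisfiesRecurrence = ∀ v →
    let z : ℕ → ℕ → Carrier
        z i j = x (v ⊕ (+ i , + j))
    in
    0# ≈ z 0 0 ² * z 1 2 ²
       + z 1 0 ² * z 0 2 ²
       + ((α₂ ² - α₁ ²) / 4# ∵ 0<4) * z 0 1 ² * z 1 1 ²
       - α₁ * (z 0 0 * z 0 2 * z 1 1 ² + z 1 0 * z 1 2 * z 0 1 ²)
       - 2# * z 0 0 * z 1 0 * z 0 2 * z 1 2
       - α₂ * (z 0 0 * z 1 2 * z 0 1 * z 1 1 + z 1 0 * z 0 2 * z 0 1 * z 1 1)

  -- z₁₂ = (… + √D) / 2z₀₀², the square root being the witness r.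
  IsLargerRoot : (∀ s → 0# < x s) → Set (c ⊔ ℓ₁ ⊔ ℓ₃)
  IsLargerRoot x>0 = ∀ v →
    let z : ℕ → ℕ → Carrier
        z i j = x (v ⊕ (+ i , + j))
        D = (α₁ * z 0 1 ² + 4# * z 0 0 * z 0 2)
          * (α₁ * (z 0 0 ² * z 1 1 ² + z 0 1 ² * z 1 0 ²)
             + 2# * α₂ * z 0 0 * z 0 1 * z 1 0 * z 1 1)
    in
    ∃[ r ] r IsSqrtOf D ×
      z 1 2 ≈ (α₁ * z 1 0 * z 0 1 ² + 2# * z 0 0 * z 1 0 * z 0 2 + α₂ * z 0 0 * z 0 1 * z 1 1 + r)
              / (2# * z 0 0 ²) ∵ 0<2x² (x>0 (v ⊕ (+ 0 , + 0)))

{-# OPTIONS --safe #-}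
module Submission where

-- Each R⁰ is a partial derivative of the recurrence polynomial P, quadratic in every
-- corner variable, so on P = 0 its square is the discriminant, which factors as R¹ R².
-- Put X = z₀₀z₁₂, Y = z₁₀z₀₂, M = z₀₁z₁₁ and e = 2 (X - Y) - α₂ M.  That z₁₂ is the larger
-- root forces e ≥ 0, and then P = 0 shows that the derivatives at the corners
-- z₁₂ and z₀₀ are ≥ 0 and those at z₀₂ and z₁₀ are ≤ 0.  Relative to its own box, w₁ is the
-- corner z₁₂, w₂ is z₀₂, w₃ is z₀₀ and w₄ is z₁₀, so R⁰B₁ R⁰B₃ and R⁰B₂ R⁰B₄ are both
-- ≥ 0; they have the same square R¹S₁ R¹S₂ R²C₁ R²C₂, hence agree, and both
-- identities follow.

open import Algebra.Bundles using (CommutativeMonoid; CommutativeRing; RawRing)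
import Algebra.Properties.AbelianGroup as AbelianGroupProperties
import Algebra.Properties.CommutativeSemigroup as CommutativeSemigroupProperties
import Algebra.Properties.Ring as RingProperties
import Algebra.Properties.Semiring.Mult.TCOptimised as Mult
import Algebra.Solver.Ring as RingSolver
open import Algebra.Solver.Ring.AlmostCommutativeRing using (_-Raw-AlmostCommutative⟶_; fromCommutativeRing)
open import Data.Integer.Base as ℤ using (ℤ; +_; -[1+_]; _◃_; _⊖_)
import Data.Integer.Properties as ℤₚ
open import Data.Maybe.Base using (Maybe; just; nothing)
open import Data.Nat.Base as ℕ using (ℕ; zero; suc)
open import Data.Product.Base using (_×_; _,_; proj₁)
open import Data.Sign.Base as Sign using ()
open import Data.Sum.Base using (inj₁; inj₂; [_,_]′)
open import Defs
open import Relation.Binary.PropositionalEquality.Core as ≡ using (_≡_)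
import Relation.Binary.Reasoning.Setoid as SetoidReasoning
open import Relation.Nullary.Decidable.Core using (yes; no)
open import Relation.Nullary.Negation using (contradiction)

-- Ring solver with integer coefficients over an arbitrary commutative ring.

module IntegerCoefficients {c ℓ} (R : CommutativeRing c ℓ) where
  open CommutativeRing R
  open RingProperties ring using (-‿distribˡ-*; -‿distribʳ-*; -‿involutive; -0#≈0#)
  open AbelianGroupProperties +-abelianGroup using () renaming (⁻¹-∙-comm to -‿+-comm)
  open CommutativeSemigroupProperties
    (CommutativeMonoid.commutativeSemigroup +-commutativeMonoid)
    using (interchange)
  open Mult semiring using (1+×; ×-homo-+; ×1-homo-*) renaming (_×_ to _·_)
  open SetoidReasoning setoid

  -- The optimised multiple makes `1 · 1#` reduce to `1#`, so `con (+ 1)` denotes `1#`, and later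
  -- `:2` and `:4` denote `2#` and `4#`, definitionally.
  ⟦_⟧ℤ : ℤ → Carrier
  ⟦ + n ⟧ℤ      = n · 1#
  ⟦ -[1+ n ] ⟧ℤ = - (suc n · 1#)

  ⊖-homo : ∀ m n → ⟦ m ⊖ n ⟧ℤ ≈ m · 1# - n · 1#
  ⊖-homo m       zero    = sym (trans (+-congˡ -0#≈0#) (+-identityʳ _))
  ⊖-homo zero    (suc n) = sym (+-identityˡ _)
  ⊖-homo (suc m) (suc n) = begin
    ⟦ suc m ⊖ suc n ⟧ℤ                ≡⟨ ≡.cong ⟦_⟧ℤ (ℤₚ.[1+m]⊖[1+n]≡m⊖n m n) ⟩
    ⟦ m ⊖ n ⟧ℤ                        ≈⟨ ⊖-homo m n ⟩
    m · 1# - n · 1#                   ≈⟨ +-identityˡ _ ⟨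
    0# + (m · 1# - n · 1#)            ≈⟨ +-congʳ (-‿inverseʳ 1#) ⟨
    (1# - 1#) + (m · 1# - n · 1#)     ≈⟨ interchange _ _ _ _ ⟩
    (1# + m · 1#) + (- 1# - n · 1#)   ≈⟨ +-congˡ (-‿+-comm _ _) ⟩
    (1# + m · 1#) - (1# + n · 1#)     ≈⟨ +-cong (1+× m 1#) (-‿cong (1+× n 1#)) ⟨
    suc m · 1# - suc n · 1#           ∎

  ⟦⟧-+ : ∀ i j → ⟦ i ℤ.+ j ⟧ℤ ≈ ⟦ i ⟧ℤ + ⟦ j ⟧ℤ
  ⟦⟧-+ (+ m)    (+ n)    = ×-homo-+ 1# m n
  ⟦⟧-+ (+ m)    -[1+ n ] = ⊖-homo m (suc n)
  ⟦⟧-+ -[1+ m ] (+ n)    = trans (⊖-homo n (suc m)) (+-comm _ _)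
  ⟦⟧-+ -[1+ m ] -[1+ n ] = begin
    ⟦ -[1+ m ] ℤ.+ -[1+ n ] ⟧ℤ         ≡⟨ ≡.cong ⟦_⟧ℤ (≡.sym (ℤₚ.neg-distrib-+ (+ suc m) (+ suc n))) ⟩
    - ((suc m ℕ.+ suc n) · 1#)         ≈⟨ -‿cong (×-homo-+ 1# (suc m) (suc n)) ⟩
    - (suc m · 1# + suc n · 1#)        ≈⟨ -‿+-comm _ _ ⟨
    - (suc m · 1#) + - (suc n · 1#)    ∎

  ⟦⟧-neg : ∀ i → ⟦ ℤ.- i ⟧ℤ ≈ - ⟦ i ⟧ℤ
  ⟦⟧-neg (+ zero)  = sym -0#≈0#
  ⟦⟧-neg (+ suc n) = refl
  ⟦⟧-neg -[1+ n ]  = sym (-‿involutive _)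

  ⟦⟧-* : ∀ i j → ⟦ i ℤ.* j ⟧ℤ ≈ ⟦ i ⟧ℤ * ⟦ j ⟧ℤ
  ⟦⟧-* (+ m) (+ n) = begin
    ⟦ Sign.+ ◃ (m ℕ.* n) ⟧ℤ  ≡⟨ ≡.cong ⟦_⟧ℤ (ℤₚ.+◃n≡+n (m ℕ.* n)) ⟩
    (m ℕ.* n) · 1#           ≈⟨ ×1-homo-* m n ⟩
    m · 1# * n · 1#          ∎
  ⟦⟧-* (+ m) -[1+ n ] = begin
    ⟦ Sign.- ◃ (m ℕ.* suc n) ⟧ℤ  ≡⟨ ≡.cong ⟦_⟧ℤ (ℤₚ.-◃n≡-n (m ℕ.* suc n)) ⟩
    ⟦ ℤ.- + (m ℕ.* suc n) ⟧ℤ     ≈⟨ ⟦⟧-neg (+ (m ℕ.* suc n)) ⟩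
    - ((m ℕ.* suc n) · 1#)       ≈⟨ -‿cong (×1-homo-* m (suc n)) ⟩
    - (m · 1# * suc n · 1#)      ≈⟨ -‿distribʳ-* _ _ ⟩
    m · 1# * - (suc n · 1#)      ∎
  ⟦⟧-* -[1+ m ] (+ n) = begin
    ⟦ Sign.- ◃ (suc m ℕ.* n) ⟧ℤ  ≡⟨ ≡.cong ⟦_⟧ℤ (ℤₚ.-◃n≡-n (suc m ℕ.* n)) ⟩
    ⟦ ℤ.- + (suc m ℕ.* n) ⟧ℤ     ≈⟨ ⟦⟧-neg (+ (suc m ℕ.* n)) ⟩
    - ((suc m ℕ.* n) · 1#)       ≈⟨ -‿cong (×1-homo-* (suc m) n) ⟩
    - (suc m · 1# * n · 1#)      ≈⟨ -‿distribˡ-* _ _ ⟩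
    - (suc m · 1#) * n · 1#      ∎
  ⟦⟧-* -[1+ m ] -[1+ n ] = begin
    (suc m ℕ.* suc n) · 1#             ≈⟨ ×1-homo-* (suc m) (suc n) ⟩
    suc m · 1# * suc n · 1#            ≈⟨ -‿involutive _ ⟨
    - - (suc m · 1# * suc n · 1#)      ≈⟨ -‿cong (-‿distribʳ-* _ _) ⟩
    - (suc m · 1# * - (suc n · 1#))    ≈⟨ -‿distribˡ-* _ _ ⟩
    - (suc m · 1#) * - (suc n · 1#)    ∎

  ℤ-rawRing : RawRing _ _
  ℤ-rawRing = CommutativeRing.rawRing ℤₚ.+-*-commutativeRing

  homomorphism : ℤ-rawRing -Raw-AlmostCommutative⟶ fromCommutativeRing R
  homomorphism = record
    { ⟦_⟧    = ⟦_⟧ℤ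
    ; +-homo = ⟦⟧-+
    ; *-homo = ⟦⟧-*
    ; -‿homo = ⟦⟧-neg
    ; 0-homo = refl
    ; 1-homo = refl
    }

  -- Equality in `R` need not be decidable, so coefficients are compared as integers. `nothing`
  -- asserts no inequality: distinct integers may have equal images.
  _≈?_ : ∀ i j → Maybe (⟦ i ⟧ℤ ≈ ⟦ j ⟧ℤ)
  i ≈? j with i ℤₚ.≟ j
  ... | yes i≡j = just (reflexive (≡.cong ⟦_⟧ℤ i≡j))
  ... | no  _   = nothing

  module Solver = RingSolver ℤ-rawRing (fromCommutativeRing R) homomorphism _≈?_

-- Order, squares and division in a constructive ordered field.

module OrderProperties {c ℓ₁ ℓ₂ ℓ₃} (ℝ : Reals c ℓ₁ ℓ₂ ℓ₃) where
  open Reals ℝ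

  commutativeRing : CommutativeRing c ℓ₁
  commutativeRing = record { isCommutativeRing = isCommutativeRing }

  open IntegerCoefficients commutativeRing using (module Solver)
  open Solver using (solve; con; _:=_; _:+_; _:*_; _:-_; :-_)

  0≤-resp-≈ : ∀ {x y} → x ≈ y → 0# ≤ x → 0# ≤ y
  0≤-resp-≈ x≈y 0≤x y<0 = 0≤x (<-respˡ-≈ (sym x≈y) y<0)

  <⇒≤ : ∀ {x y} → x < y → x ≤ y
  <⇒≤ = <-asym

  x<y⇒0<y-x : ∀ {x y} → x < y → 0# < y - x
  x<y⇒0<y-x {x} x<y = <-respˡ-≈ (-‿inverseʳ x) (+-monoˡ-< (- x) x<y)

  0<-x⇒x<0 : ∀ {x} → 0# < - x → x < 0#
  0<-x⇒x<0 {x} p = <-respˡ-≈ (+-identityˡ x) (<-respʳ-≈ (-‿inverseˡ x) (+-monoˡ-< x p))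

  -- Cotransitivity places `y` against `x + y < 0#`: either `y < 0#`, or `x + y < y` and so
  -- `x < 0#`.
  +-0≤ : ∀ {x y} → 0# ≤ x → 0# ≤ y → 0# ≤ x + y
  +-0≤ {x} {y} 0≤x 0≤y x+y<0 with <-cotrans x+y<0 y
  ... | inj₂ y<0   = 0≤y y<0
  ... | inj₁ x+y<y = 0≤x (0<-x⇒x<0 (<-respʳ-≈ y-[x+y]≈-x (x<y⇒0<y-x x+y<y)))
    where
    y-[x+y]≈-x : y - (x + y) ≈ - x
    y-[x+y]≈-x = solve 2 (λ x y → y :- (x :+ y) := :- x) refl x y

  ≤-antisym : ∀ {x y} → x ≤ y → y ≤ x → x ≈ y
  ≤-antisym {x} {y} x≤y y≤x = proj₁ (tight x y) λ x#y → [ y≤x , x≤y ]′ (#⇒<⊎> x#y)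

  -- The signs of `x` and `y` cannot be decided. If `x * y < 0#`, a positive `x` would force
  -- `y ≈ 0#` and a zero product; hence `x ≈ 0#`, and the product is zero again.
  *-0≤ : ∀ {x y} → 0# ≤ x → 0# ≤ y → 0# ≤ x * y
  *-0≤ {x} {y} 0≤x 0≤y xy<0 = <-irrefl (trans (*-congʳ x≈0) (zeroˡ y)) xy<0
    where
    0<x⇒y≈0 : 0# < x → y ≈ 0#
    0<x⇒y≈0 0<x = ≤-antisym (λ 0<y → <-asym xy<0 (0<x∧0<y⇒0<x*y 0<x 0<y)) 0≤y

    x≈0 : x ≈ 0#
    x≈0 = ≤-antisym (λ 0<x → <-irrefl (trans (*-congˡ (0<x⇒y≈0 0<x)) (zeroʳ x)) xy<0) 0≤x

  *-cancelˡ-0≤ : ∀ {x y} → 0# < x → 0# ≤ x * y → 0# ≤ y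
  *-cancelˡ-0≤ {x} {y} 0<x 0≤xy y<0 =
    0≤xy (0<-x⇒x<0 (<-respʳ-≈ x[0-y]≈-xy (0<x∧0<y⇒0<x*y 0<x (x<y⇒0<y-x y<0))))
    where
    x[0-y]≈-xy : x * (0# - y) ≈ - (x * y)
    x[0-y]≈-xy = solve 2 (λ x y → x :* (con (+ 0) :- y) := :- (x :* y)) refl x y

  -- If `x < y`, then `(y - x) * x` and `(y - x) * - y` differ by `y ² - x ²`, which vanishes.
  -- Cancelling `y - x` gives `0# ≤ - y`, against `0# ≤ x` and `x < y`.
  ²-cancel-≤ : ∀ {x y} → 0# ≤ x → x ² ≈ y ² → y ≤ x
  ²-cancel-≤ {x} {y} 0≤x x²≈y² x<y = *-cancelˡ-0≤ 0<y-x 0≤[y-x]*-y -y<0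
    where
    0<y-x : 0# < y - x
    0<y-x = x<y⇒0<y-x x<y

    -y<0 : - y < 0#
    -y<0 with <-cotrans x<y 0#
    ... | inj₁ x<0 = contradiction x<0 0≤x
    ... | inj₂ 0<y = 0<-x⇒x<0 (<-respʳ-≈ (solve 1 (λ y → y := :- :- y) refl y) 0<y)

    0≤[y-x]*-y : 0# ≤ (y - x) * - y
    0≤[y-x]*-y = 0≤-resp-≈ eq (*-0≤ (<⇒≤ 0<y-x) 0≤x)
      where
      open SetoidReasoning setoid
      eq : (y - x) * x ≈ (y - x) * - y
      eq = begin
        (y - x) * x                  ≈⟨ solve 2 (λ x y → (y :- x) :* x := (y :- x) :* (:- y) :+ (y :* y :- x :* x)) refl x y ⟩
        (y - x) * - y + (y ² - x ²)  ≈⟨ +-congˡ (+-congˡ (-‿cong x²≈y²)) ⟩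
        (y - x) * - y + (y ² - y ²)  ≈⟨ +-congˡ (-‿inverseʳ _) ⟩
        (y - x) * - y + 0#           ≈⟨ +-identityʳ _ ⟩
        (y - x) * - y                ∎

  ²-injective-0≤ : ∀ {x y} → 0# ≤ x → 0# ≤ y → x ² ≈ y ² → x ≈ y
  ²-injective-0≤ 0≤x 0≤y x²≈y² = ≤-antisym (²-cancel-≤ 0≤y (sym x²≈y²)) (²-cancel-≤ 0≤x x²≈y²)

  *-/-cancel : ∀ a {b} (0<b : 0# < b) → b * (a / b ∵ 0<b) ≈ a
  *-/-cancel a {b} 0<b with #⇒invertible (#-sym (<⇒# 0<b))
  ... | b⁻¹ , b⁻¹b≈1 , _ = begin
    -- `#⇒invertible` inverts the difference of two apart elements, here `b - 0#` rather than `b`.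
    b * (a * b⁻¹)           ≈⟨ solve 3 (λ a b c → b :* (a :* c) := a :* (c :* (b :- con (+ 0)))) refl a b b⁻¹ ⟩
    a * (b⁻¹ * (b - 0#))    ≈⟨ *-congˡ b⁻¹b≈1 ⟩
    a * 1#                  ≈⟨ *-identityʳ a ⟩
    a                       ∎
    where open SetoidReasoning setoid

  module _ {r₁ r₂ r₃ r₄ s₁ s₂ c₁ c₂ : Carrier}
           (0≤r₁ : 0# ≤ r₁) (0≤-r₂ : 0# ≤ - r₂) (0≤r₃ : 0# ≤ r₃) (0≤-r₄ : 0# ≤ - r₄)
           (r₁²≈ : r₁ ² ≈ s₁ * c₁) (r₂²≈ : r₂ ² ≈ s₁ * c₂)
           (r₃²≈ : r₃ ² ≈ s₂ * c₂) (r₄²≈ : r₄ ² ≈ s₂ * c₁) where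
    open SetoidReasoning setoid

    private
      *-² : ∀ a b → (a * b) ² ≈ a ² * b ²
      *-² = solve 2 (λ a b → (a :* b) :* (a :* b) := (a :* a) :* (b :* b)) refl

    diagonals-equal : r₁ * r₃ ≈ r₂ * r₄
    diagonals-equal = ²-injective-0≤ (*-0≤ 0≤r₁ 0≤r₃) 0≤r₂r₄ (begin
      (r₁ * r₃) ²            ≈⟨ *-² r₁ r₃ ⟩
      r₁ ² * r₃ ²            ≈⟨ *-cong r₁²≈ r₃²≈ ⟩
      s₁ * c₁ * (s₂ * c₂)    ≈⟨ solve 4 (λ s₁ s₂ c₁ c₂ → s₁ :* c₁ :* (s₂ :* c₂) := s₁ :* c₂ :* (s₂ :* c₁)) refl s₁ s₂ c₁ c₂ ⟩
      s₁ * c₂ * (s₂ * c₁)    ≈⟨ *-cong r₂²≈ r₄²≈ ⟨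
      r₂ ² * r₄ ²            ≈⟨ *-² r₂ r₄ ⟨
      (r₂ * r₄) ²            ∎)
      where
      0≤r₂r₄ : 0# ≤ r₂ * r₄
      0≤r₂r₄ = 0≤-resp-≈ (solve 2 (λ a b → (:- a) :* (:- b) := a :* b) refl r₂ r₄) (*-0≤ 0≤-r₂ 0≤-r₄)

    -- The four squares alone fix the product only up to sign; `diagonals-equal` removes the
    -- ambiguity by turning it into the square of `r₁ * r₃`.
    product-of-four : r₁ * r₂ * r₃ * r₄ ≈ s₁ * s₂ * c₁ * c₂
    product-of-four = begin
      r₁ * r₂ * r₃ * r₄      ≈⟨ solve 4 (λ r₁ r₂ r₃ r₄ → r₁ :* r₂ :* r₃ :* r₄ := r₁ :* r₃ :* (r₂ :* r₄)) refl r₁ r₂ r₃ r₄ ⟩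
      r₁ * r₃ * (r₂ * r₄)    ≈⟨ *-congˡ diagonals-equal ⟨
      (r₁ * r₃) ²            ≈⟨ *-² r₁ r₃ ⟩
      r₁ ² * r₃ ²            ≈⟨ *-cong r₁²≈ r₃²≈ ⟩
      s₁ * c₁ * (s₂ * c₂)    ≈⟨ solve 4 (λ s₁ s₂ c₁ c₂ → s₁ :* c₁ :* (s₂ :* c₂) := s₁ :* s₂ :* c₁ :* c₂) refl s₁ s₂ c₁ c₂ ⟩
      s₁ * s₂ * c₁ * c₂      ∎

-- The recurrence polynomial of a single box: discriminants and symmetries.

module Box {c ℓ₁ ℓ₂ ℓ₃} (ℝ : Reals c ℓ₁ ℓ₂ ℓ₃)
           (α₁ α₂ : Reals.Carrier ℝ) where
  open Reals ℝ
  open OrderProperties ℝ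
  open IntegerCoefficients commutativeRing using (module Solver)
  open Solver using (Polynomial; solve; con; _:=_; _:+_; _:*_; _:-_; :-_)
  open SetoidReasoning setoid

  κ : Carrier
  κ = (α₂ ² - α₁ ²) / 4# ∵ 0<4

  -- The solver has no division, so `κ` enters its identities as a free variable; this relation then
  -- kills the leftover multiple of `(α₂ ² - α₁ ²) - 4# * κ`.
  4κ≈α₂²-α₁² : 4# * κ ≈ α₂ ² - α₁ ²
  4κ≈α₂²-α₁² = *-/-cancel _ 0<4

  P : (z₀₀ z₀₁ z₀₂ z₁₀ z₁₁ z₁₂ : Carrier) → Carrier
  P z₀₀ z₀₁ z₀₂ z₁₀ z₁₁ z₁₂ =
      z₀₀ ² * z₁₂ ²
    + z₁₀ ² * z₀₂ ²
    + κ * z₀₁ ² * z₁₁ ²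
    - α₁ * (z₀₀ * z₀₂ * z₁₁ ² + z₁₀ * z₁₂ * z₀₁ ²)
    - 2# * z₀₀ * z₁₀ * z₀₂ * z₁₂
    - α₂ * (z₀₀ * z₁₂ * z₀₁ * z₁₁ + z₁₀ * z₀₂ * z₀₁ * z₁₁)

  -- ∂P/∂z₁₂; by the symmetries of P, the derivatives at the other corners are ∂P with
  -- the arguments reflected.
  ∂P : (z₀₀ z₀₁ z₀₂ z₁₀ z₁₁ z₁₂ : Carrier) → Carrier
  ∂P z₀₀ z₀₁ z₀₂ z₁₀ z₁₁ z₁₂ =
      2# * z₀₀ ² * z₁₂
    - α₁ * z₁₀ * z₀₁ ²
    - 2# * z₀₀ * z₁₀ * z₀₂
    - α₂ * z₀₀ * z₀₁ * z₁₁

  segment : (z₀₀ z₀₁ z₀₂ : Carrier) → Carrier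
  segment z₀₀ z₀₁ z₀₂ = α₁ * z₀₁ ² + 4# * z₀₀ * z₀₂

  square : (z₀₀ z₀₁ z₁₀ z₁₁ : Carrier) → Carrier
  square z₀₀ z₀₁ z₁₀ z₁₁ =
      α₁ * (z₀₀ ² * z₁₁ ² + z₀₁ ² * z₁₀ ²)
    + 2# * α₂ * z₀₀ * z₀₁ * z₁₀ * z₁₁

  private
    infix 10 _:²
    _:² : ∀ {n} → Polynomial n → Polynomial n
    p :² = p :* p

    :2 :4 : ∀ {n} → Polynomial n
    :2 = con (+ 1) :+ con (+ 1)
    :4 = :2 :+ :2

    :P : ∀ {n} (a₁ a₂ k z₀₀ z₀₁ z₀₂ z₁₀ z₁₁ z₁₂ : Polynomial n) → Polynomial n
    :P a₁ a₂ k z₀₀ z₀₁ z₀₂ z₁₀ z₁₁ z₁₂ =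
         z₀₀ :² :* z₁₂ :²
      :+ z₁₀ :² :* z₀₂ :²
      :+ k :* z₀₁ :² :* z₁₁ :²
      :- a₁ :* (z₀₀ :* z₀₂ :* z₁₁ :² :+ z₁₀ :* z₁₂ :* z₀₁ :²)
      :- :2 :* z₀₀ :* z₁₀ :* z₀₂ :* z₁₂
      :- a₂ :* (z₀₀ :* z₁₂ :* z₀₁ :* z₁₁ :+ z₁₀ :* z₀₂ :* z₀₁ :* z₁₁)

    :∂P : ∀ {n} (a₁ a₂ z₀₀ z₀₁ z₀₂ z₁₀ z₁₁ z₁₂ : Polynomial n) → Polynomial n
    :∂P a₁ a₂ z₀₀ z₀₁ z₀₂ z₁₀ z₁₁ z₁₂ =
         :2 :* z₀₀ :² :* z₁₂
      :- a₁ :* z₁₀ :* z₀₁ :²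
      :- :2 :* z₀₀ :* z₁₀ :* z₀₂
      :- a₂ :* z₀₀ :* z₀₁ :* z₁₁

    :segment : ∀ {n} (a₁ z₀₀ z₀₁ z₀₂ : Polynomial n) → Polynomial n
    :segment a₁ z₀₀ z₀₁ z₀₂ = a₁ :* z₀₁ :² :+ :4 :* z₀₀ :* z₀₂

    :square : ∀ {n} (a₁ a₂ z₀₀ z₀₁ z₁₀ z₁₁ : Polynomial n) → Polynomial n
    :square a₁ a₂ z₀₀ z₀₁ z₁₀ z₁₁ =
         a₁ :* (z₀₀ :² :* z₁₁ :² :+ z₀₁ :² :* z₁₀ :²)
      :+ :2 :* a₂ :* z₀₀ :* z₀₁ :* z₁₀ :* z₁₁

  -- Completing the square in `z₁₂`, where `P` has leading coefficient `z₀₀ ²`: `∂P ²` is the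
  -- discriminant plus `4# * z₀₀ ² * P`.
  discriminant : ∀ {z₀₀ z₀₁ z₀₂ z₁₀ z₁₁ z₁₂} → 0# ≈ P z₀₀ z₀₁ z₀₂ z₁₀ z₁₁ z₁₂ →
    ∂P z₀₀ z₀₁ z₀₂ z₁₀ z₁₁ z₁₂ ² ≈ segment z₀₀ z₀₁ z₀₂ * square z₀₀ z₀₁ z₁₀ z₁₁
  discriminant {z₀₀} {z₀₁} {z₀₂} {z₁₀} {z₁₁} {z₁₂} P≈0 = begin
    ∂P z₀₀ z₀₁ z₀₂ z₁₀ z₁₁ z₁₂ ²
      ≈⟨ solve 9 (λ a₁ a₂ k z₀₀ z₀₁ z₀₂ z₁₀ z₁₁ z₁₂ →
           :∂P a₁ a₂ z₀₀ z₀₁ z₀₂ z₁₀ z₁₁ z₁₂ :² :=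
           :segment a₁ z₀₀ z₀₁ z₀₂ :* :square a₁ a₂ z₀₀ z₀₁ z₁₀ z₁₁
             :+ :4 :* z₀₀ :² :* :P a₁ a₂ k z₀₀ z₀₁ z₀₂ z₁₀ z₁₁ z₁₂
             :+ (z₀₀ :* z₀₁ :* z₁₁) :² :* ((a₂ :² :- a₁ :²) :- :4 :* k))
         refl α₁ α₂ κ z₀₀ z₀₁ z₀₂ z₁₀ z₁₁ z₁₂ ⟩
    D + 4# * z₀₀ ² * P z₀₀ z₀₁ z₀₂ z₁₀ z₁₁ z₁₂
      + (z₀₀ * z₀₁ * z₁₁) ² * ((α₂ ² - α₁ ²) - 4# * κ)
      ≈⟨ +-cong (+-congˡ (*-congˡ (sym P≈0))) (*-congˡ (+-congˡ (-‿cong 4κ≈α₂²-α₁²))) ⟩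
    D + 4# * z₀₀ ² * 0# + (z₀₀ * z₀₁ * z₁₁) ² * ((α₂ ² - α₁ ²) - (α₂ ² - α₁ ²))
      ≈⟨ solve 4 (λ d s t k → d :+ s :* con (+ 0) :+ t :* (k :- k) := d) refl D _ _ _ ⟩
    D ∎
    where
    D : Carrier
    D = segment z₀₀ z₀₁ z₀₂ * square z₀₀ z₀₁ z₁₀ z₁₁

  P-flip₁ : ∀ z₀₀ z₀₁ z₀₂ z₁₀ z₁₁ z₁₂ →
    P z₀₀ z₀₁ z₀₂ z₁₀ z₁₁ z₁₂ ≈ P z₁₀ z₁₁ z₁₂ z₀₀ z₀₁ z₀₂
  P-flip₁ = solve 9 (λ a₁ a₂ k z₀₀ z₀₁ z₀₂ z₁₀ z₁₁ z₁₂ →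
      :P a₁ a₂ k z₀₀ z₀₁ z₀₂ z₁₀ z₁₁ z₁₂ := :P a₁ a₂ k z₁₀ z₁₁ z₁₂ z₀₀ z₀₁ z₀₂)
    refl α₁ α₂ κ

  P-flip₂ : ∀ z₀₀ z₀₁ z₀₂ z₁₀ z₁₁ z₁₂ →
    P z₀₀ z₀₁ z₀₂ z₁₀ z₁₁ z₁₂ ≈ P z₀₂ z₀₁ z₀₀ z₁₂ z₁₁ z₁₀
  P-flip₂ = solve 9 (λ a₁ a₂ k z₀₀ z₀₁ z₀₂ z₁₀ z₁₁ z₁₂ →
      :P a₁ a₂ k z₀₀ z₀₁ z₀₂ z₁₀ z₁₁ z₁₂ := :P a₁ a₂ k z₀₂ z₀₁ z₀₀ z₁₂ z₁₁ z₁₀)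
    refl α₁ α₂ κ

  segment-flip : ∀ z₀₀ z₀₁ z₀₂ → segment z₀₀ z₀₁ z₀₂ ≈ segment z₀₂ z₀₁ z₀₀
  segment-flip = solve 4 (λ a₁ z₀₀ z₀₁ z₀₂ → :segment a₁ z₀₀ z₀₁ z₀₂ := :segment a₁ z₀₂ z₀₁ z₀₀) refl α₁

  square-flip₁ : ∀ z₀₀ z₀₁ z₁₀ z₁₁ → square z₀₀ z₀₁ z₁₀ z₁₁ ≈ square z₁₀ z₁₁ z₀₀ z₀₁
  square-flip₁ = solve 6 (λ a₁ a₂ z₀₀ z₀₁ z₁₀ z₁₁ →
      :square a₁ a₂ z₀₀ z₀₁ z₁₀ z₁₁ := :square a₁ a₂ z₁₀ z₁₁ z₀₀ z₀₁)
    refl α₁ α₂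

  square-flip₂ : ∀ z₀₀ z₀₁ z₁₀ z₁₁ → square z₀₀ z₀₁ z₁₀ z₁₁ ≈ square z₀₁ z₀₀ z₁₁ z₁₀
  square-flip₂ = solve 6 (λ a₁ a₂ z₀₀ z₀₁ z₁₀ z₁₁ →
      :square a₁ a₂ z₀₀ z₀₁ z₁₀ z₁₁ := :square a₁ a₂ z₀₁ z₀₀ z₁₁ z₁₀)
    refl α₁ α₂

  -- The subscript names the corner variable in which `P` is taken as a quadratic; a reflection of
  -- the box moves that corner to `z₁₂`. The factors are always the segment and the square that
  -- avoid the corner.
  discriminant₀₂ : ∀ {z₀₀ z₀₁ z₀₂ z₁₀ z₁₁ z₁₂} → 0# ≈ P z₀₀ z₀₁ z₀₂ z₁₀ z₁₁ z₁₂ →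
    ∂P z₁₀ z₁₁ z₁₂ z₀₀ z₀₁ z₀₂ ² ≈ segment z₁₀ z₁₁ z₁₂ * square z₀₀ z₀₁ z₁₀ z₁₁
  discriminant₀₂ P≈0 =
    trans (discriminant (trans P≈0 (P-flip₁ _ _ _ _ _ _))) (*-congˡ (square-flip₁ _ _ _ _))

  discriminant₁₀ : ∀ {z₀₀ z₀₁ z₀₂ z₁₀ z₁₁ z₁₂} → 0# ≈ P z₀₀ z₀₁ z₀₂ z₁₀ z₁₁ z₁₂ →
    ∂P z₀₂ z₀₁ z₀₀ z₁₂ z₁₁ z₁₀ ² ≈ segment z₀₀ z₀₁ z₀₂ * square z₀₁ z₀₂ z₁₁ z₁₂
  discriminant₁₀ P≈0 =
    trans (discriminant (trans P≈0 (P-flip₂ _ _ _ _ _ _)))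
          (*-cong (segment-flip _ _ _) (square-flip₂ _ _ _ _))

  discriminant₀₀ : ∀ {z₀₀ z₀₁ z₀₂ z₁₀ z₁₁ z₁₂} → 0# ≈ P z₀₀ z₀₁ z₀₂ z₁₀ z₁₁ z₁₂ →
    ∂P z₁₂ z₁₁ z₁₀ z₀₂ z₀₁ z₀₀ ² ≈ segment z₁₀ z₁₁ z₁₂ * square z₀₁ z₀₂ z₁₁ z₁₂
  discriminant₀₀ P≈0 =
    trans (discriminant₁₀ (trans P≈0 (P-flip₁ _ _ _ _ _ _))) (*-congˡ (square-flip₁ _ _ _ _))

  -- Signs of the four corner derivatives.

  module Signs (0≤α₁ : 0# ≤ α₁) (0≤α₂ : 0# ≤ α₂)
               {z₀₀ z₀₁ z₀₂ z₁₀ z₁₁ z₁₂ : Carrier}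
               (0<z₀₀ : 0# < z₀₀) (0<z₀₁ : 0# < z₀₁) (0<z₀₂ : 0# < z₀₂)
               (0<z₁₀ : 0# < z₁₀) (0<z₁₁ : 0# < z₁₁) (0<z₁₂ : 0# < z₁₂)
               (P≈0 : 0# ≈ P z₀₀ z₀₁ z₀₂ z₁₀ z₁₁ z₁₂)
               (0≤∂₁₂ : 0# ≤ ∂P z₀₀ z₀₁ z₀₂ z₁₀ z₁₁ z₁₂) where

    private
      infixl 6 _⊞_
      infixl 7 _⊠_

      _⊞_ : ∀ {x y} → 0# ≤ x → 0# ≤ y → 0# ≤ x + y
      _⊞_ = +-0≤

      _⊠_ : ∀ {x y} → 0# ≤ x → 0# ≤ y → 0# ≤ x * y
      _⊠_ = *-0≤

      X Y M U V e : Carrier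
      X = z₀₀ * z₁₂
      Y = z₁₀ * z₀₂
      M = z₀₁ * z₁₁
      U = z₀₀ * z₀₂ * z₁₁ ²
      V = z₁₀ * z₁₂ * z₀₁ ²
      e = 2# * (X - Y) - α₂ * M

      0≤2 : 0# ≤ 2#
      0≤2 = <⇒≤ 0<2

      0≤4 : 0# ≤ 4#
      0≤4 = <⇒≤ 0<4

      0≤Y : 0# ≤ Y
      0≤Y = <⇒≤ 0<z₁₀ ⊠ <⇒≤ 0<z₀₂

      0≤M : 0# ≤ M
      0≤M = <⇒≤ 0<z₀₁ ⊠ <⇒≤ 0<z₁₁

      0≤U : 0# ≤ U
      0≤U = <⇒≤ 0<z₀₀ ⊠ <⇒≤ 0<z₀₂ ⊠ (<⇒≤ 0<z₁₁ ⊠ <⇒≤ 0<z₁₁)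

      0≤V : 0# ≤ V
      0≤V = <⇒≤ 0<z₁₀ ⊠ <⇒≤ 0<z₁₂ ⊠ (<⇒≤ 0<z₀₁ ⊠ <⇒≤ 0<z₀₁)

      -- Multiplying `∂P` by `z₁₂` makes it a polynomial in `X`, `Y`, `M`, `V`, namely
      -- `X * e - α₁ * V`; the positive factor `X` then cancels.
      0≤e : 0# ≤ e
      0≤e = *-cancelˡ-0≤ (0<x∧0<y⇒0<x*y 0<z₀₀ 0<z₁₂)
        (0≤-resp-≈ (sym Xe≈) (<⇒≤ 0<z₁₂ ⊠ 0≤∂₁₂ ⊞ 0≤α₁ ⊠ 0≤V))
        where
        Xe≈ : X * e ≈ z₁₂ * ∂P z₀₀ z₀₁ z₀₂ z₁₀ z₁₁ z₁₂ + α₁ * V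
        Xe≈ = solve 8 (λ a₁ a₂ z₀₀ z₀₁ z₀₂ z₁₀ z₁₁ z₁₂ →
            z₀₀ :* z₁₂ :* (:2 :* (z₀₀ :* z₁₂ :- z₁₀ :* z₀₂) :- a₂ :* (z₀₁ :* z₁₁)) :=
            z₁₂ :* :∂P a₁ a₂ z₀₀ z₀₁ z₀₂ z₁₀ z₁₁ z₁₂ :+ a₁ :* (z₁₀ :* z₁₂ :* z₀₁ :²))
          refl α₁ α₂ z₀₀ z₀₁ z₀₂ z₁₀ z₁₁ z₁₂

    -- Multiplied by `z₀₂`, the negated derivative is `2# * Y * (X - Y) + α₂ * M * Y + α₁ * U`.
    -- Eliminating `X` in favour of `e` leaves only nonnegative terms. The corner `z₁₀` is the same
    -- with `V` for `U`.
    0≤-∂₀₂ : 0# ≤ - ∂P z₁₀ z₁₁ z₁₂ z₀₀ z₀₁ z₀₂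
    0≤-∂₀₂ = *-cancelˡ-0≤ 0<z₀₂ (0≤-resp-≈ (sym eq) (0≤Y ⊠ 0≤e ⊞ 0≤2 ⊠ 0≤α₂ ⊠ 0≤M ⊠ 0≤Y ⊞ 0≤α₁ ⊠ 0≤U))
      where
      eq : z₀₂ * - ∂P z₁₀ z₁₁ z₁₂ z₀₀ z₀₁ z₀₂ ≈ Y * e + 2# * α₂ * M * Y + α₁ * U
      eq = solve 8 (λ a₁ a₂ z₀₀ z₀₁ z₀₂ z₁₀ z₁₁ z₁₂ →
          z₀₂ :* (:- :∂P a₁ a₂ z₁₀ z₁₁ z₁₂ z₀₀ z₀₁ z₀₂) :=
          z₁₀ :* z₀₂ :* (:2 :* (z₀₀ :* z₁₂ :- z₁₀ :* z₀₂) :- a₂ :* (z₀₁ :* z₁₁))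
            :+ :2 :* a₂ :* (z₀₁ :* z₁₁) :* (z₁₀ :* z₀₂)
            :+ a₁ :* (z₀₀ :* z₀₂ :* z₁₁ :²))
        refl α₁ α₂ z₀₀ z₀₁ z₀₂ z₁₀ z₁₁ z₁₂

    0≤-∂₁₀ : 0# ≤ - ∂P z₀₂ z₀₁ z₀₀ z₁₂ z₁₁ z₁₀
    0≤-∂₁₀ = *-cancelˡ-0≤ 0<z₁₀ (0≤-resp-≈ (sym eq) (0≤Y ⊠ 0≤e ⊞ 0≤2 ⊠ 0≤α₂ ⊠ 0≤M ⊠ 0≤Y ⊞ 0≤α₁ ⊠ 0≤V))
      where
      eq : z₁₀ * - ∂P z₀₂ z₀₁ z₀₀ z₁₂ z₁₁ z₁₀ ≈ Y * e + 2# * α₂ * M * Y + α₁ * V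
      eq = solve 8 (λ a₁ a₂ z₀₀ z₀₁ z₀₂ z₁₀ z₁₁ z₁₂ →
          z₁₀ :* (:- :∂P a₁ a₂ z₀₂ z₀₁ z₀₀ z₁₂ z₁₁ z₁₀) :=
          z₁₀ :* z₀₂ :* (:2 :* (z₀₀ :* z₁₂ :- z₁₀ :* z₀₂) :- a₂ :* (z₀₁ :* z₁₁))
            :+ :2 :* a₂ :* (z₀₁ :* z₁₁) :* (z₁₀ :* z₀₂)
            :+ a₁ :* (z₁₀ :* z₁₂ :* z₀₁ :²))
        refl α₁ α₂ z₀₀ z₀₁ z₀₂ z₁₀ z₁₁ z₁₂

    -- Here `α₁ * U` enters with a minus sign, so `0≤e` does not suffice: the term `e ²`, evaluated
    -- through the recurrence, has to absorb it.
    0≤∂₀₀ : 0# ≤ ∂P z₁₂ z₁₁ z₁₀ z₀₂ z₀₁ z₀₀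
    0≤∂₀₀ = *-cancelˡ-0≤ 0<z₀₀ (*-cancelˡ-0≤ 0<2 (0≤-resp-≈ (sym eq)
        ( (0≤α₁ ⊠ 0≤α₁) ⊠ (0≤M ⊠ 0≤M) ⊞ 0≤2 ⊠ 0≤α₁ ⊠ 0≤U ⊞ 0≤4 ⊠ 0≤α₁ ⊠ 0≤V
        ⊞ 0≤4 ⊠ 0≤2 ⊠ 0≤α₂ ⊠ 0≤M ⊠ 0≤Y ⊞ 0≤α₂ ⊠ 0≤M ⊠ 0≤e ⊞ 0≤2 ⊠ 0≤Y ⊠ 0≤e)))
      where
      W : Carrier
      W = α₁ ² * M ² + 2# * α₁ * U + 4# * α₁ * V
        + 4# * 2# * α₂ * M * Y + α₂ * M * e + 2# * Y * e

      -- 2 z₀₀ ∂₀₀ = 2 X e - 2 α₁ U, where 2 X = e + α₂ M + 2 Y and, as 4 P = 0,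
      -- e² = α₁² M² + 4 α₁ (U + V) + 8 α₂ M Y.
      eq : 2# * (z₀₀ * ∂P z₁₂ z₁₁ z₁₀ z₀₂ z₀₁ z₀₀) ≈ W
      eq = begin
        2# * (z₀₀ * ∂P z₁₂ z₁₁ z₁₀ z₀₂ z₀₁ z₀₀)
          ≈⟨ solve 9 (λ a₁ a₂ k z₀₀ z₀₁ z₀₂ z₁₀ z₁₁ z₁₂ →
               let X = z₀₀ :* z₁₂
                   Y = z₁₀ :* z₀₂
                   M = z₀₁ :* z₁₁
                   U = z₀₀ :* z₀₂ :* z₁₁ :²
                   V = z₁₀ :* z₁₂ :* z₀₁ :²
                   e = :2 :* (X :- Y) :- a₂ :* M
               in
               :2 :* (z₀₀ :* :∂P a₁ a₂ z₁₂ z₁₁ z₁₀ z₀₂ z₀₁ z₀₀) :=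
               (a₁ :² :* M :² :+ :2 :* a₁ :* U :+ :4 :* a₁ :* V
                 :+ :4 :* :2 :* a₂ :* M :* Y :+ a₂ :* M :* e :+ :2 :* Y :* e)
                 :+ :4 :* :P a₁ a₂ k z₀₀ z₀₁ z₀₂ z₁₀ z₁₁ z₁₂
                 :+ M :² :* ((a₂ :² :- a₁ :²) :- :4 :* k))
             refl α₁ α₂ κ z₀₀ z₀₁ z₀₂ z₁₀ z₁₁ z₁₂ ⟩
        W + 4# * P z₀₀ z₀₁ z₀₂ z₁₀ z₁₁ z₁₂ + M ² * ((α₂ ² - α₁ ²) - 4# * κ)
          ≈⟨ +-cong (+-congˡ (*-congˡ (sym P≈0))) (*-congˡ (+-congˡ (-‿cong 4κ≈α₂²-α₁²))) ⟩
        W + 4# * 0# + M ² * ((α₂ ² - α₁ ²) - (α₂ ² - α₁ ²))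
          ≈⟨ solve 4 (λ d s t k → d :+ s :* con (+ 0) :+ t :* (k :- k) := d) refl W _ _ _ ⟩
        W ∎

-- The four boxes around a lattice point.

module Configuration {c ℓ₁ ℓ₂ ℓ₃} (ℝ : Reals c ℓ₁ ℓ₂ ℓ₃)
                     (α₁ α₂ : Reals.Carrier ℝ) (x : Point → Reals.Carrier ℝ) where
  open Reals ℝ
  open Recurrence ℝ α₁ α₂ x
  open OrderProperties ℝ
  open IntegerCoefficients commutativeRing using (module Solver)
  open Solver using (solve; _:=_; _:+_; _:-_)
  open SetoidReasoning setoid

  open Box ℝ α₁ α₂

  module AroundPoint (0≤α₁ : 0# ≤ α₁) (0≤α₂ : 0# ≤ α₂) (x>0 : ∀ s → 0# < x s)
              (recurrence : SatisfiesRecurrence) (largerRoot : IsLargerRoot x>0) (v : Point) where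

    -- Clearing the denominator in the root formula leaves exactly `√D`. The choice of the larger
    -- root enters the proof only here.
    0≤R⁰ : ∀ w → 0# ≤ R⁰ (B₁ w)
    0≤R⁰ w with largerRoot w
    ... | √D , (0≤√D , _) , z₁₂≈ = 0≤-resp-≈ (sym R⁰≈√D) 0≤√D
      where
      z : ℕ → ℕ → Carrier
      z i j = x (w ⊕ (+ i , + j))

      a b d : Carrier
      a = α₁ * z 1 0 * z 0 1 ²
      b = 2# * z 0 0 * z 1 0 * z 0 2
      d = α₂ * z 0 0 * z 0 1 * z 1 1

      R⁰≈√D : R⁰ (B₁ w) ≈ √D
      R⁰≈√D = begin
        2# * z 0 0 ² * z 1 2 - a - b - d
          ≈⟨ +-congʳ (+-congʳ (+-congʳ (trans (*-congˡ z₁₂≈) (*-/-cancel _ _)))) ⟩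
        a + b + d + √D - a - b - d
          ≈⟨ solve 4 (λ a b d r → a :+ b :+ d :+ r :- a :- b :- d := r) refl a b d √D ⟩
        √D ∎

    -- Offsets are taken from `v` because sums of closed integers compute, while `v ⊕ p ⊕ q` is
    -- stuck on the variable `v`. After reassociation by the shift lemmas, values reached from
    -- different base points coincide definitionally.
    y : Point → Carrier
    y p = x (v ⊕ p)

    P-at : Point → Carrier
    P-at p = P (y (p ⊕ (+ 0 , + 0))) (y (p ⊕ (+ 0 , + 1))) (y (p ⊕ (+ 0 , + 2)))
               (y (p ⊕ (+ 1 , + 0))) (y (p ⊕ (+ 1 , + 1))) (y (p ⊕ (+ 1 , + 2)))

    P-at≈0 : ∀ p → 0# ≈ P-at p
    P-at≈0 p
      rewrite ≡.sym (⊕-assoc v p (+ 0 , + 0)) | ≡.sym (⊕-assoc v p (+ 0 , + 1)) | ≡.sym (⊕-assoc v p (+ 0 , + 2))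
            | ≡.sym (⊕-assoc v p (+ 1 , + 0)) | ≡.sym (⊕-assoc v p (+ 1 , + 1)) | ≡.sym (⊕-assoc v p (+ 1 , + 2))
      = recurrence (v ⊕ p)

    R⁰-shift : ∀ p s t → R⁰ (box (v ⊕ p) s t) ≡
      ∂P (y (p ⊕ (s ◃ 0 , t ◃ 0))) (y (p ⊕ (s ◃ 0 , t ◃ 1))) (y (p ⊕ (s ◃ 0 , t ◃ 2)))
         (y (p ⊕ (s ◃ 1 , t ◃ 0))) (y (p ⊕ (s ◃ 1 , t ◃ 1))) (y (p ⊕ (s ◃ 1 , t ◃ 2)))
    R⁰-shift p s t
      rewrite ⊕-assoc v p (s ◃ 0 , t ◃ 0) | ⊕-assoc v p (s ◃ 0 , t ◃ 1) | ⊕-assoc v p (s ◃ 0 , t ◃ 2)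
            | ⊕-assoc v p (s ◃ 1 , t ◃ 0) | ⊕-assoc v p (s ◃ 1 , t ◃ 1) | ⊕-assoc v p (s ◃ 1 , t ◃ 2)
      = ≡.refl

    R¹-shift : ∀ p → R¹ (v ⊕ p) ≡
      segment (y (p ⊕ (+ 0 , + 0))) (y (p ⊕ (+ 0 , + 1))) (y (p ⊕ (+ 0 , + 2)))
    R¹-shift p
      rewrite ⊕-assoc v p (+ 0 , + 0) | ⊕-assoc v p (+ 0 , + 1) | ⊕-assoc v p (+ 0 , + 2)
      = ≡.refl

    R²-shift : ∀ p → R² (v ⊕ p) ≡
      square (y (p ⊕ (+ 0 , + 0))) (y (p ⊕ (+ 0 , + 1))) (y (p ⊕ (+ 1 , + 0))) (y (p ⊕ (+ 1 , + 1)))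
    R²-shift p
      rewrite ⊕-assoc v p (+ 0 , + 0) | ⊕-assoc v p (+ 0 , + 1)
            | ⊕-assoc v p (+ 1 , + 0) | ⊕-assoc v p (+ 1 , + 1)
      = ≡.refl

    module SignsAt (p : Point) =
      Signs 0≤α₁ 0≤α₂ (x>0 _) (x>0 _) (x>0 _) (x>0 _) (x>0 _) (x>0 _) (P-at≈0 p)
        (≡.subst (0# ≤_) (R⁰-shift p Sign.+ Sign.+) (0≤R⁰ (v ⊕ p)))

    -- The offset given to `SignsAt` is the lower left corner of the box. `B₂` is marked from `v`
    -- and unfolds by computation; `B₃` and `B₄` are marked from `v ⊕ (+ 0 , + 1)` and need
    -- `R⁰-shift`.
    0≤-R⁰B₂ : 0# ≤ - R⁰ (B₂ v)
    0≤-R⁰B₂ = SignsAt.0≤-∂₀₂ (-[1+ 0 ] , + 0)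

    0≤R⁰B₃ : 0# ≤ R⁰ (B₃ v)
    0≤R⁰B₃ rewrite R⁰-shift (+ 0 , + 1) Sign.- Sign.- = SignsAt.0≤∂₀₀ (-[1+ 0 ] , -[1+ 0 ])

    0≤-R⁰B₄ : 0# ≤ - R⁰ (B₄ v)
    0≤-R⁰B₄ rewrite R⁰-shift (+ 0 , + 1) Sign.+ Sign.- = SignsAt.0≤-∂₁₀ (+ 0 , -[1+ 0 ])

    S₁ S₂ C₁ C₂ : Point
    S₁ = v
    S₂ = v ⊕ (+ 0 , -[1+ 0 ])
    C₁ = v
    C₂ = v ⊕ (-[1+ 0 ] , + 0)

    R⁰B₁² : R⁰ (B₁ v) ² ≈ R¹ S₁ * R² C₁
    R⁰B₁² = discriminant (recurrence v)

    -- Every distinguished corner lies off the vertical line through `v` and outside rows 0 and 1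
    -- relative to `v`. So the segment avoiding it is `S₁` or `S₂`, and the square avoiding it is
    -- `C₁` or `C₂`.
    R⁰B₂² : R⁰ (B₂ v) ² ≈ R¹ S₁ * R² C₂
    R⁰B₂² rewrite R²-shift (-[1+ 0 ] , + 0) = discriminant₀₂ (P-at≈0 (-[1+ 0 ] , + 0))

    R⁰B₃² : R⁰ (B₃ v) ² ≈ R¹ S₂ * R² C₂
    R⁰B₃²
      rewrite R⁰-shift (+ 0 , + 1) Sign.- Sign.- | R¹-shift (+ 0 , -[1+ 0 ]) | R²-shift (-[1+ 0 ] , + 0)
      = discriminant₀₀ (P-at≈0 (-[1+ 0 ] , -[1+ 0 ]))

    R⁰B₄² : R⁰ (B₄ v) ² ≈ R¹ S₂ * R² C₁
    R⁰B₄²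
      rewrite R⁰-shift (+ 0 , + 1) Sign.+ Sign.- | R¹-shift (+ 0 , -[1+ 0 ])
      = discriminant₁₀ (P-at≈0 (+ 0 , -[1+ 0 ]))

theorem6p9 : ∀ {c ℓ₁ ℓ₂ ℓ₃} (ℝ : Reals c ℓ₁ ℓ₂ ℓ₃) →
    let open Reals ℝ in
    (α₁ α₂ : Carrier) → 0# ≤ α₁ → 0# ≤ α₂ →
    (x : Point → Carrier) (x>0 : ∀ s → 0# < x s) →
    let open Recurrence ℝ α₁ α₂ x in
    SatisfiesRecurrence →
    IsLargerRoot x>0 →
    ∀ v →
    let S₁ = v
        S₂ = v ⊕ (+ 0 , -[1+ 0 ])
        C₁ = v
        C₂ = v ⊕ (-[1+ 0 ] , + 0)
    in
    (R⁰ (B₁ v) * R⁰ (B₂ v) * R⁰ (B₃ v) * R⁰ (B₄ v) ≈ R¹ S₁ * R¹ S₂ * R² C₁ * R² C₂)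
    × (R⁰ (B₁ v) * R⁰ (B₃ v) ≈ R⁰ (B₂ v) * R⁰ (B₄ v))
theorem6p9 ℝ α₁ α₂ 0≤α₁ 0≤α₂ x x>0 recurrence largerRoot v =
    product-of-four (0≤R⁰ v) 0≤-R⁰B₂ 0≤R⁰B₃ 0≤-R⁰B₄ R⁰B₁² R⁰B₂² R⁰B₃² R⁰B₄²
  , diagonals-equal (0≤R⁰ v) 0≤-R⁰B₂ 0≤R⁰B₃ 0≤-R⁰B₄ R⁰B₁² R⁰B₂² R⁰B₃² R⁰B₄²
  where
  open OrderProperties ℝ
  open Configuration.AroundPoint ℝ α₁ α₂ x 0≤α₁ 0≤α₂ x>0 recurrence largerRoot v
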